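{- Let $\mathcal{K}$ be a FUR-class with monster model $\mathbb{M}$, and suppose $p\in S(\mathbb{M})$ is a global type. Then there is some $\alpha\in\mathbb{M}^{eq}$ such that $\alpha$ is a canonical base for $p$.
   Context: SETTING. $(\mathcal{K},\preccurlyeq)$ is an abstract elementary class (AEC) with monster model $\mathbb{M}$: a $\delta$-model homogeneous and $\delta$-universal member of $\mathcal{K}$, $\delta$ a large cardinal. "Model" means $\mathcal{A}\in\mathcal{K}$, $\mathcal{A}\preccurlyeq\mathbb{M}$; models and parameter sets have size $<\delta$ unless $\mathbb{M}$ itself is mentioned. $a\in X$ may be a finite tuple; juxtaposition denotes union or concatenation. TYPES. $\mathrm{Aut}(\mathbb{M}/A)$ is the group of automorphisms of $\mathbb{M}$ fixing $A$ pointwise. $a,b$ have the same Galois type over $A$, $t^g(a/A)=t^g(b/A)$, if $f(a)=b$ for some $f\in\mathrm{Aut}(\mathbb{M}/A)$; they have the same weak type, $t(a/A)=t(b/A)$, if $t^g(a/B)=t^g(b/B)$ for all finite $B\subseteq A$ (types of models are types of enumerations). For $A\subseteq B$ with $A$ finite, $t(a/B)$ splits over $A$ if there are $b,c\in B$ with $t(b/A)=t(c/A)$ but $t(ab/A)\ne t(ac/A)$. $a\downarrow^{ns}_B C$ means that $t(a/B\cup C)$ does not split over some finite $A\subseteq B$; $A\downarrow^{ns}_B C$ means $a\downarrow^{ns}_BC$ for each $a\in A$. FUR-CLASS. $\mathcal{K}$ is a FUR-class if it has AP and JEP, $LS(\mathcal{K})=\omega$, has arbitrarily large structures, contains no finite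 models, and satisfies: (AI) Every countable model $\mathcal{A}$ is s-saturated: for any $b\in\mathbb{M}$ and finite $A\subseteq\mathcal{A}$ there is $a\in\mathcal{A}$ with $t(a/A)=t(b/A)$. (AII) For all $a$ and countable $\mathcal{A}$ there is an s-primary model $\mathcal{B}=\mathcal{A}a\cup\bigcup_{i<\omega}a_i$ over $\mathcal{A}a$. [s-primary: the $a_i$ are singletons and for all $n<\omega$ there is a finite $A_n\subset\mathcal{A}$ such that for all $(a',a_0',\dots,a_n')$ with $t(a'/\mathcal{A})=t(a/\mathcal{A})$: $t(a',a_0',\dots,a_n'/A_n)=t(a,a_0,\dots,a_n/A_n)$ implies $t(a',a_0',\dots,a_n'/\mathcal{A})=t(a,a_0,\dots,a_n/\mathcal{A})$.] (AIII) Let $\mathcal{A},\mathcal{B},\mathcal{C}$ be models with $\mathcal{A}\downarrow^{ns}_{\mathcal{B}}\mathcal{C}$ and $\mathcal{B}=\mathcal{A}\cap\mathcal{C}$. Then there is a unique (not only up to isomorphism) s-prime model $\mathcal{D}$ over $\mathcal{A}\cup\mathcal{C}$; furthermore, if $\mathcal{C}\subseteq\mathcal{C}'$ and $\mathcal{A}\downarrow^{ns}_{\mathcal{B}}\mathcal{C}'$, then $\mathcal{D}\downarrow^{ns}_{\mathcal{C}}\mathcal{C}'$. [For models $\mathcal{A}_i$, $i<\alpha$, and $A=\bigcup_{i<\alpha}\mathcal{A}_i$, a map $f:A\to\mathbb{M}$ is weakly elementary w.r.t. $(\mathcal{A}_i)_{i<\alpha}$ if $t(a/\emptyset)=t(f(a)/\emptyset)$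 for all $a\in A$ and $f(\mathcal{A}_i)\preccurlyeq\mathbb{M}$ for all $i$. A model $\mathcal{D}$ is s-prime over $A$ if for every model $\mathcal{B}$ and every $f:A\to\mathcal{B}$ weakly elementary w.r.t. $(\mathcal{A}_i)_{i<\alpha}$ there is an elementary embedding $g:\mathcal{D}\to\mathcal{B}$ with $f\subseteq g$.] (AIV) For each $a\in\mathbb{M}$ there is $n<\omega$ such that for every countable model $\mathcal{A}$ and finite $A\subset\mathcal{A}$, player II has a winning strategy in $GI(a,A,\mathcal{A})$ in $n$ moves. [$GI(a,A,\mathcal{A})$: start with $a_0=a$, $A_0=A$. At move $n$, player I chooses $a_{n+1}\in\mathbb{M}$ and a finite $A_{n+1}'\subseteq\mathcal{A}$ with $t(a_{n+1}/A_n)=t(a_n/A_n)$, $A_n\subseteq A'_{n+1}$ and $t(a_{n+1}/A'_{n+1})\ne t(a_n/A'_{n+1})$; then player II chooses a finite $A_{n+1}\subseteq\mathcal{A}$ with $A'_{n+1}\subseteq A_{n+1}$. Player II wins if player I can no longer move.] (AV) If $\mathcal{A}\subseteq\mathcal{B}$ are countable models, $a\in\mathbb{M}$ and $\mathcal{B}\downarrow^{ns}_{\mathcal{A}}a$, then $a\downarrow^{ns}_{\mathcal{A}}\mathcal{B}$. (AVI) For all models $\mathcal{A},\mathcal{B},\mathcal{D}$ with $\mathcal{A}\subseteq\mathcal{B}\cap\mathcal{D}$ there is a model $\mathcal{C}$ with $t(\mathcal{C}/\mathcal{A})=t(\mathcal{B}/\mathcal{A})$ and $\mathcal{C}\downarrow^{ns}_{\mathcal{A}}\mathcal{D}$.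 IMAGINARIES. $\mathcal{E}$ is a countable collection of $\emptyset$-invariant equivalence relations $E\subseteq\mathbb{M}^n\times\mathbb{M}^n$ (various $n$), containing equality, each given by a countable collection $G_E$ of Galois types via $(a,b)\in E$ iff $t^g(ab/\emptyset)\in G_E$. $\mathbb{M}^{eq}=\{a/E:a\in\mathbb{M},E\in\mathcal{E}\}$, with $a$ identified with $a/{=}$, the structure of $\mathbb{M}$ on $P_=$, and predicates $P_E$ for $\{a/E:a\in\mathbb{M}\}$ and functions $F_E(a)=a/E$. Automorphisms of $\mathbb{M}$ extend to $\mathbb{M}^{eq}$. GLOBAL TYPES. The supermonster $\mathbb{M}'\in\mathcal{K}$ is a $|\mathbb{M}'|$-model homogeneous and universal structure with $\mathbb{M}\preccurlyeq\mathbb{M}'$ and $|\mathbb{M}'|>|\mathbb{M}|$; every $f\in\mathrm{Aut}(\mathbb{M})$ extends to an automorphism of $\mathbb{M}'$. Types of elements of $\mathbb{M}'$ are computed in $\mathbb{M}'$. A global type $p$ is a maximal collection $\{p_A:A\subset\mathbb{M}\text{ finite}\}$ such that $p_A$ is a Galois type over $A$, whenever $A\subseteq B$ and $b\in\mathbb{M}$ realizes $p_B$ then $b$ realizes $p_A$, and some single $b\in\mathbb{M}'$ realizes $p_A$ for every finite $A\subset\mathbb{M}$. $S(\mathbb{M})$ is the set of global types. For $f\in\mathrm{Aut}(\mathbb{M}^{eq})$, $f(p)=p$ means: for all finite $A,B\subset\mathbb{M}$ with $f(B)=A$ and all $b$ realizing $p_B$, $f(b)$ realizes $p_A$. An element $\alpha\in\mathbb{M}^{eq}$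 is a canonical base for $p$ if for every $f\in\mathrm{Aut}(\mathbb{M}^{eq})$: $f(p)=p$ iff $f(\alpha)=\alpha$. STANDING CHOICE OF $\mathcal{E}$. For $p\in S(\mathbb{M})$ realized by $b\in\mathbb{M}'$ with $t(b/\mathbb{M})$ not splitting over a finite tuple $a\in\mathbb{M}$: for $c\in\mathbb{M}$ let $q_c=t(bc/\emptyset)$ and let $q_i^c$, $i<\omega$, be types over $\emptyset$ such that for all $d\in\mathbb{M}$, $bd$ realizes $q_c$ iff $ad$ realizes $q_i^c$ for some $i<\omega$ (these exist by non-splitting). Let $(a_0,a_1)\in E$ iff for all $c,d\in\mathbb{M}$: $a_0d$ realizes $\bigvee_{i<\omega}q_i^c$ iff $a_1d$ realizes $\bigvee_{i<\omega}q_i^c$. The relation $E$ depends only on $t(ba/\emptyset)$, so there are only countably many such $E$; $\mathcal{E}$ is assumed to contain all of them. -}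

module Defs where

open import Level using (Level; _⊔_) renaming (suc to lsuc)
open import Data.Fin using (Fin; zero; suc; toℕ)
open import Data.Nat using (ℕ; zero; suc; _+_)
open import Data.Product using (Σ; ∃; _×_; _,_)
open import Data.Sum using (_⊎_)
open import Data.Vec.Functional using (Vector; []; _∷_; _++_)
open import Function using (_∘_; id)
open import Function.Bundles using (_↣_; _⇔_; module Injection)
open import Function.Definitions using (Injective; Surjective)
open import Induction.WellFounded using (WellFounded)
open import Relation.Binary using (Rel; IsStrictTotalOrder; IsEquivalence)
open import Relation.Binary.PropositionalEquality using (_≡_; _≗_)
open import Relation.Nullary using (¬_)
open import Relation.Unary using (Pred; _∈_; _⊆_; _∪_; _∩_; _≐_; ∅)

-- Cardinals are represented by types: |X| ≤ |Y| is X ↣ Y, and a cardinal such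
-- as δ or |X| + ω is given by any type of that size.

infix 4 _<ᶜ_

_<ᶜ_ : ∀ {a b} → Set a → Set b → Set (a ⊔ b)
X <ᶜ Y = (X ↣ Y) × ¬ (Y ↣ X)

Countable : ∀ {a} → Set a → Set a
Countable X = X ↣ ℕ

record Language (ℓ : Level) : Set (lsuc ℓ) where
  field
    Fun Rl : ℕ → Set ℓ

  Symbol : Set ℓ
  Symbol = Σ ℕ Fun ⊎ Σ ℕ Rl

open Language

-- Vectors are functions on Fin n, so interpretations are required to respect
-- pointwise equality.

record Structure {ℓ} (L : Language ℓ) : Set (lsuc ℓ) where
  field
    ∣_∣      : Set ℓ
    fun      : ∀ {n} → Fun L n → Vector ∣_∣ n → ∣_∣
    rel      : ∀ {n} → Rl L n → Pred (Vector ∣_∣ n) ℓ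
    fun-cong : ∀ {n} (F : Fun L n) {xs ys} → xs ≗ ys → fun F xs ≡ fun F ys
    rel-resp : ∀ {n} (R : Rl L n) {xs ys} → xs ≗ ys → rel R xs → rel R ys

open Structure public

record IsEmbedding {ℓ} {L : Language ℓ} (A B : Structure L)
                   (f : ∣ A ∣ → ∣ B ∣) : Set ℓ where
  field
    injective : Injective _≡_ _≡_ f
    on-fun    : ∀ {n} (F : Fun L n) xs → f (fun A F xs) ≡ fun B F (f ∘ xs)
    on-rel    : ∀ {n} (R : Rl L n) xs → rel A R xs ⇔ rel B R (f ∘ xs)

infix 4 _≅_

record _≅_ {ℓ} {L : Language ℓ} (A B : Structure L) : Set ℓ where
  field
    to          : ∣ A ∣ → ∣ B ∣
    isEmbedding : IsEmbedding A B to
    surjective  : Surjective _≡_ _≡_ to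

open _≅_ public

Aut : ∀ {ℓ} {L : Language ℓ} → Structure L → Set ℓ
Aut N = N ≅ N

record Chain {ℓ} (L : Language ℓ) : Set (lsuc ℓ) where
  field
    Index       : Set ℓ
    _<_         : Rel Index ℓ
    isOrder     : IsStrictTotalOrder _≡_ _<_
    wellFounded : WellFounded _<_
    inhabitant  : Index
    obj         : Index → Structure L
    map         : ∀ {i j} → i < j → ∣ obj i ∣ → ∣ obj j ∣
    map-∘       : ∀ {i j k} (p : i < j) (q : j < k) (r : i < k) →
                  map q ∘ map p ≗ map r

-- The union of a chain is determined up to isomorphism.

record IsUnion {ℓ} {L : Language ℓ} (C : Chain L) (U : Structure L)
               (g : ∀ i → ∣ Chain.obj C i ∣ → ∣ U ∣) : Set ℓ where
  open Chain C
  field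
    embedding : ∀ i → IsEmbedding (obj i) U (g i)
    commutes  : ∀ {i j} (p : i < j) → g j ∘ map p ≗ g i
    covers    : ∀ u → ∃ λ i → ∃ λ x → g i x ≡ u

-- Structures live on different types, so literal inclusions are replaced by
-- maps: Strong A B f says that f is an isomorphism of A onto some A′ ≼ B.
-- Thus for A, B ≼ C the inclusion A ⊆ B becomes a factorisation through B of
-- the map A → C, and antisymmetry of ≼ is automatic.

record AEC {ℓ} (L : Language ℓ) : Set (lsuc (lsuc ℓ)) where
  field
    K      : Pred (Structure L) (lsuc ℓ)
    Strong : (A B : Structure L) → (∣ A ∣ → ∣ B ∣) → Set (lsuc ℓ)

    strong⇒K         : ∀ {A B f} → Strong A B f → K A × K B
    strong⇒embedding : ∀ {A B f} → Strong A B f → IsEmbedding A B f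

    K-iso      : ∀ {A B} → A ≅ B → K A → K B
    strong-iso : ∀ {A A′ B B′ f f′} (α : A ≅ A′) (β : B ≅ B′) →
                 to β ∘ f ≗ f′ ∘ to α → Strong A B f → Strong A′ B′ f′

    strong-id  : ∀ {A} → K A → Strong A A id
    strong-∘   : ∀ {A B C f g} → Strong A B f → Strong B C g → Strong A C (g ∘ f)
    coherence  : ∀ {A B C f g} → Strong B C g → Strong A C (g ∘ f) → Strong A B f

  StrongChain : Chain L → Set (lsuc ℓ)
  StrongChain C = let open Chain C in
    (∀ i → K (obj i)) × (∀ {i j} (p : i < j) → Strong (obj i) (obj j) (map p))

  field
    union-K      : ∀ {C U g} → StrongChain C → IsUnion C U g → K U
    union-strong : ∀ {C U g} → StrongChain C → IsUnion C U g →
                   ∀ i → Strong (Chain.obj C i) U (g i)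
    union-least  : ∀ {C U g} → StrongChain C → IsUnion C U g →
                   ∀ {N} (h : ∣ U ∣ → ∣ N ∣) →
                   (∀ i → Strong (Chain.obj C i) N (h ∘ g i)) → Strong U N h

  -- |L| ≤ κ, and every X ⊆ A is contained in some B ≼ A with |B| ≤ |X| + κ.
  -- LS(K) is the least infinite κ with this property, so LS(K) = ω iff ω has it.
  IsLöwenheimSkolem : ∀ {k} → Set k → Set (k ⊔ lsuc ℓ)
  IsLöwenheimSkolem κ =
    (Symbol L ↣ κ) ×
    (∀ {A} → K A → (X : Set ℓ) (x : X ↣ ∣ A ∣) →
       ∃ λ B → ∃ λ f → Strong B A f × (∣ B ∣ ↣ (X ⊎ κ)) ×
         (∀ i → ∃ λ b → f b ≡ Injection.to x i))

  field
    löwenheimSkolem : ∃ λ (κ : Set ℓ) → (ℕ ↣ κ) × IsLöwenheimSkolem κ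

module _ {ℓ} {L : Language ℓ} (𝒦 : AEC L) where
  open AEC 𝒦

  ModelHomogeneous : Set ℓ → Structure L → Set (lsuc ℓ)
  ModelHomogeneous κ N =
    ∀ A → ∣ A ∣ <ᶜ κ → ∀ f g → Strong A N f → Strong A N g →
    ∃ λ (σ : Aut N) → to σ ∘ f ≗ g

  Universal : Set ℓ → Structure L → Set (lsuc ℓ)
  Universal κ N = ∀ A → K A → ∣ A ∣ <ᶜ κ → ∃ λ f → Strong A N f

  record IsMonster (κ : Set ℓ) (N : Structure L) : Set (lsuc ℓ) where
    field
      inK         : K N
      homogeneous : ModelHomogeneous κ N
      universal   : Universal κ N

  record IsSupermonster (𝕄 𝕄′ : Structure L) (ι : ∣ 𝕄 ∣ → ∣ 𝕄′ ∣) :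
                        Set (lsuc ℓ) where
    field
      isMonster : IsMonster ∣ 𝕄′ ∣ 𝕄′
      strong    : Strong 𝕄 𝕄′ ι
      larger    : ∣ 𝕄 ∣ <ᶜ ∣ 𝕄′ ∣
      extends   : (σ : Aut 𝕄) → ∃ λ (τ : Aut 𝕄′) → to τ ∘ ι ≗ ι ∘ to σ

-- Finite tuples, and finite sets, are vectors.

⟦_⟧ : ∀ {a} {X : Set a} {n} → Vector X n → Pred X a
⟦ a ⟧ x = ∃ λ i → a i ≡ x

infix 4 _∈ᵗ_

_∈ᵗ_ : ∀ {a x n} {X : Set a} → Vector X n → Pred X x → Set x
a ∈ᵗ P = ∀ i → a i ∈ P

module Types {ℓ} {L : Language ℓ} (N : Structure L) where

  private
    Tuple : ℕ → Set ℓ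
    Tuple = Vector ∣ N ∣

  Fixes : ∀ {x} → Aut N → Pred ∣ N ∣ x → Set (ℓ ⊔ x)
  Fixes σ X = ∀ {y} → y ∈ X → to σ y ≡ y

  -- Equality of the Galois types over X of two families; for a tuple the index
  -- type is Fin n, for an enumeration of a model it is arbitrary.
  SameGalois : ∀ {x i} {I : Set i} → Pred ∣ N ∣ x →
               (a b : I → ∣ N ∣) → Set (ℓ ⊔ x ⊔ i)
  SameGalois X a b = ∃ λ (σ : Aut N) → Fixes σ X × (to σ ∘ a ≗ b)

  SameType : ∀ {x i} {I : Set i} → Pred ∣ N ∣ x →
             (a b : I → ∣ N ∣) → Set (ℓ ⊔ x ⊔ i)
  SameType X a b =
    ∀ {k} (B : Tuple k) → B ∈ᵗ X → SameGalois ⟦ B ⟧ a b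

  Splits : ∀ {x n k} → Tuple n → Pred ∣ N ∣ x → Tuple k → Set (ℓ ⊔ x)
  Splits a B A =
    ∃ λ m → ∃ λ (b : Tuple m) → ∃ λ (c : Tuple m) →
      b ∈ᵗ B × c ∈ᵗ B × SameType ⟦ A ⟧ b c ×
      ¬ SameType ⟦ A ⟧ (a ++ b) (a ++ c)

  infix 4 _↓[_]_ _⇓[_]_

  _↓[_]_ : ∀ {n} → Tuple n → Pred ∣ N ∣ ℓ → Pred ∣ N ∣ ℓ → Set ℓ
  a ↓[ B ] C = ∃ λ k → ∃ λ (A : Tuple k) → A ∈ᵗ B × ¬ Splits a (B ∪ C) A

  _⇓[_]_ : Pred ∣ N ∣ ℓ → Pred ∣ N ∣ ℓ → Pred ∣ N ∣ ℓ → Set ℓ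
  A ⇓[ B ] C = ∀ {n} (a : Tuple n) → a ∈ᵗ A → a ↓[ B ] C

  -- A legal move (a′, A′) of player I in the position (a, A) of GI.
  LegalMove : ∀ {n k k′} → Pred ∣ N ∣ ℓ →
              Tuple n → Tuple k → Tuple n → Tuple k′ → Set ℓ
  LegalMove 𝒜 a A a′ A′ =
    A′ ∈ᵗ 𝒜 × SameType ⟦ A ⟧ a′ a × ⟦ A ⟧ ⊆ ⟦ A′ ⟧ × ¬ SameType ⟦ A′ ⟧ a′ a

  -- Player II can play so that player I is unable to move after at most r
  -- further moves.
  IIWins : ∀ {n k} → ℕ → Pred ∣ N ∣ ℓ → Tuple n → Tuple k → Set ℓ
  IIWins zero 𝒜 a A =
    ∀ {k′} a′ (A′ : Tuple k′) → ¬ LegalMove 𝒜 a A a′ A′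
  IIWins (suc r) 𝒜 a A =
    ∀ {k′} a′ (A′ : Tuple k′) → LegalMove 𝒜 a A a′ A′ →
    ∃ λ k″ → ∃ λ (A″ : Tuple k″) →
      A″ ∈ᵗ 𝒜 × ⟦ A′ ⟧ ⊆ ⟦ A″ ⟧ × IIWins r 𝒜 a′ A″

module Models {ℓ} {L : Language ℓ} (𝒦 : AEC L) (δ : Set ℓ) (𝕄 : Structure L) where
  open AEC 𝒦
  open Types 𝕄

  private
    Tuple : ℕ → Set ℓ
    Tuple = Vector ∣ 𝕄 ∣

  record Model : Set (lsuc ℓ) where
    field
      str    : Structure L
      incl   : ∣ str ∣ → ∣ 𝕄 ∣
      strong : Strong str 𝕄 incl
      small  : ∣ str ∣ <ᶜ δ

    ∥_∥ : Pred ∣ 𝕄 ∣ ℓ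
    ∥_∥ y = ∃ λ x → incl x ≡ y

  open Model public

  CountableModel : Model → Set ℓ
  CountableModel 𝒜 = Countable ∣ str 𝒜 ∣

  IsModel : Pred ∣ 𝕄 ∣ ℓ → Set (lsuc ℓ)
  IsModel U = ∃ λ (𝒜 : Model) → ∥ 𝒜 ∥ ≐ U

  -- (s₀, s₁, …) exhibits ℬ as s-primary over 𝒜a.
  IsSPrimary : ∀ {n} → Model → Tuple n → Model → (ℕ → ∣ 𝕄 ∣) → Set ℓ
  IsSPrimary 𝒜 a ℬ s =
    (∥ ℬ ∥ ≐ (∥ 𝒜 ∥ ∪ ⟦ a ⟧ ∪ λ x → ∃ λ i → s i ≡ x)) ×
    (∀ r → ∃ λ k → ∃ λ (A : Tuple k) → A ∈ᵗ ∥ 𝒜 ∥ ×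
      (∀ a′ (s′ : Tuple (suc r)) → SameType ∥ 𝒜 ∥ a′ a →
         SameType ⟦ A ⟧ (a′ ++ s′) (a ++ initial r) →
         SameType ∥ 𝒜 ∥ (a′ ++ s′) (a ++ initial r)))
    where
    initial : ∀ r → Tuple (suc r)
    initial r i = s (toℕ i)

  ⋃∥_∥ : ∀ {n} → Vector Model n → Pred ∣ 𝕄 ∣ ℓ
  ⋃∥ 𝒜 ∥ x = ∃ λ i → x ∈ ∥ 𝒜 i ∥

  -- A partial map on ⋃ 𝒜ᵢ is given by a total map of which only the values on
  -- ⋃ 𝒜ᵢ are used.  Only finite families (𝒜ᵢ) are needed.
  WeaklyElementary : ∀ {n} → Vector Model n → (∣ 𝕄 ∣ → ∣ 𝕄 ∣) → Set (lsuc ℓ)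
  WeaklyElementary 𝒜 f =
    (∀ {m} (a : Tuple m) → a ∈ᵗ ⋃∥ 𝒜 ∥ → SameType ∅ a (f ∘ a)) ×
    (∀ i → IsModel (λ y → ∃ λ x → f (incl (𝒜 i) x) ≡ y))

  IsSPrime : ∀ {n} → Vector Model n → Model → Set (lsuc ℓ)
  IsSPrime 𝒜 𝒟 =
    ⋃∥ 𝒜 ∥ ⊆ ∥ 𝒟 ∥ ×
    (∀ (ℬ : Model) f → WeaklyElementary 𝒜 f →
      (∀ {x} → x ∈ ⋃∥ 𝒜 ∥ → f x ∈ ∥ ℬ ∥) →
      ∃ λ g → Strong (str 𝒟) (str ℬ) g ×
        (∀ d → incl 𝒟 d ∈ ⋃∥ 𝒜 ∥ → incl ℬ (g d) ≡ f (incl 𝒟 d)))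

  record IsFUR : Set (lsuc ℓ) where
    field
      AP : ∀ {A B C f g} → Strong A B f → Strong A C g →
           ∃ λ D → ∃ λ f′ → ∃ λ g′ →
             Strong B D f′ × Strong C D g′ × (f′ ∘ f ≗ g′ ∘ g)

      JEP : ∀ {A B} → K A → K B →
            ∃ λ C → ∃ λ f → ∃ λ g → Strong A C f × Strong B C g

      LS≡ω : IsLöwenheimSkolem ℕ

      arbitrarilyLarge : (X : Set ℓ) → ∃ λ A → K A × (X ↣ ∣ A ∣)

      noFinite : ∀ {A} → K A → ∀ n → ¬ (∣ A ∣ ↣ Fin n)

      AI : ∀ 𝒜 → CountableModel 𝒜 →
           ∀ {n k} (b : Tuple n) (A : Tuple k) → A ∈ᵗ ∥ 𝒜 ∥ →
           ∃ λ a → a ∈ᵗ ∥ 𝒜 ∥ × SameType ⟦ A ⟧ a b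

      AII : ∀ {n} (a : Tuple n) 𝒜 → CountableModel 𝒜 →
            ∃ λ ℬ → ∃ λ s → IsSPrimary 𝒜 a ℬ s

      AIII : ∀ 𝒜 ℬ 𝒞 → ∥ 𝒜 ∥ ⇓[ ∥ ℬ ∥ ] ∥ 𝒞 ∥ → ∥ ℬ ∥ ≐ (∥ 𝒜 ∥ ∩ ∥ 𝒞 ∥) →
             let over = 𝒜 ∷ 𝒞 ∷ [] in
             ∃ λ 𝒟 → IsSPrime over 𝒟 ×
               (∀ 𝒟′ → IsSPrime over 𝒟′ → ∥ 𝒟′ ∥ ≐ ∥ 𝒟 ∥) ×
               (∀ 𝒞′ → ∥ 𝒞 ∥ ⊆ ∥ 𝒞′ ∥ → ∥ 𝒜 ∥ ⇓[ ∥ ℬ ∥ ] ∥ 𝒞′ ∥ →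
                  ∥ 𝒟 ∥ ⇓[ ∥ 𝒞 ∥ ] ∥ 𝒞′ ∥)

      AIV : ∀ {n} (a : Tuple n) → ∃ λ r →
            ∀ 𝒜 → CountableModel 𝒜 → ∀ {k} (A : Tuple k) → A ∈ᵗ ∥ 𝒜 ∥ →
            IIWins r ∥ 𝒜 ∥ a A

      AV : ∀ 𝒜 ℬ → CountableModel 𝒜 → CountableModel ℬ → ∥ 𝒜 ∥ ⊆ ∥ ℬ ∥ →
           ∀ {n} (a : Tuple n) →
           ∥ ℬ ∥ ⇓[ ∥ 𝒜 ∥ ] ⟦ a ⟧ → a ↓[ ∥ 𝒜 ∥ ] ∥ ℬ ∥

      -- c is the enumeration of 𝒞 corresponding to the enumeration incl of ℬ.
      AVI : ∀ 𝒜 ℬ 𝒟 → ∥ 𝒜 ∥ ⊆ (∥ ℬ ∥ ∩ ∥ 𝒟 ∥) →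
            ∃ λ 𝒞 → ∃ λ (c : ∣ str ℬ ∣ → ∣ 𝕄 ∣) →
              (∥ 𝒞 ∥ ≐ λ y → ∃ λ x → c x ≡ y) ×
              SameType ∥ 𝒜 ∥ c (incl ℬ) ×
              ∥ 𝒞 ∥ ⇓[ ∥ 𝒜 ∥ ] ∥ 𝒟 ∥

-- Sort n enumerates the n-ary members of 𝓔.  A Galois type over ∅ is given by a
-- realisation; g enumerates G_E.

record Imaginaries {ℓ} {L : Language ℓ} (𝕄 : Structure L) : Set (lsuc ℓ) where
  open Types 𝕄
  field
    Sort        : ℕ → Set
    countable   : Countable (Σ ℕ Sort)
    E           : ∀ {n} → Sort n → Rel (Vector ∣ 𝕄 ∣ n) ℓ
    equivalence : ∀ {n} (s : Sort n) → IsEquivalence (E s)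
    invariant   : ∀ {n} (s : Sort n) (σ : Aut 𝕄) {a b} →
                  E s a b → E s (to σ ∘ a) (to σ ∘ b)
    G           : ∀ {n} → Sort n → Set
    G-countable : ∀ {n} (s : Sort n) → Countable (G s)
    g           : ∀ {n} (s : Sort n) → G s → Vector ∣ 𝕄 ∣ (n + n)
    E-by-types  : ∀ {n} (s : Sort n) {a b} →
                  E s a b ⇔ (∃ λ i → SameGalois ∅ (g s i) (a ++ b))
    equality    : Sort 1
    E-equality  : ∀ {a b} → E equality a b ⇔ (a zero ≡ b zero)

module Meq {ℓ} {L : Language ℓ} {𝕄 : Structure L} (𝓔 : Imaginaries 𝕄) where
  open Imaginaries 𝓔

  infix 5 _/_
  infix 4 _≈_

  -- 𝕄^eq is the setoid (𝕄eq , _≈_).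
  data 𝕄eq : Set ℓ where
    _/_ : ∀ {n} → Vector ∣ 𝕄 ∣ n → Sort n → 𝕄eq

  data _≈_ : Rel 𝕄eq ℓ where
    class : ∀ {n} {s : Sort n} {a b} → E s a b → (a / s) ≈ (b / s)

  real : ∣ 𝕄 ∣ → 𝕄eq
  real x = (λ _ → x) / equality

  P : ∀ {n} → Sort n → Pred 𝕄eq ℓ
  P s α = ∃ λ a → α ≈ (a / s)

  record AutEq : Set ℓ where
    field
      ⟨_⟩        : 𝕄eq → 𝕄eq
      cong       : ∀ {α β} → α ≈ β → ⟨_⟩ α ≈ ⟨_⟩ β
      injective  : ∀ {α β} → ⟨_⟩ α ≈ ⟨_⟩ β → α ≈ β
      surjective : ∀ β → ∃ λ α → ⟨_⟩ α ≈ β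
      on-P       : ∀ {n} (s : Sort n) α → P s α ⇔ P s (⟨_⟩ α)

    -- x ↦ y says that the automorphism takes x ∈ 𝕄 to y ∈ 𝕄.
    infix 4 _↦_
    _↦_ : Rel ∣ 𝕄 ∣ ℓ
    x ↦ y = ⟨_⟩ (real x) ≈ real y

    field
      on-fun : ∀ {n} (F : Fun L n) {x y} → (∀ i → x i ↦ y i) →
               fun 𝕄 F x ↦ fun 𝕄 F y
      on-rel : ∀ {n} (R : Rl L n) {x y} → (∀ i → x i ↦ y i) →
               rel 𝕄 R x ⇔ rel 𝕄 R y
      on-F   : ∀ {n} (s : Sort n) {a b} → (∀ i → a i ↦ b i) →
               ⟨_⟩ (a / s) ≈ (b / s)

module Global {ℓ} {L : Language ℓ} (𝕄 𝕄′ : Structure L) (ι : ∣ 𝕄 ∣ → ∣ 𝕄′ ∣) where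
  private
    module T  = Types 𝕄
    module T′ = Types 𝕄′

  -- A Galois type is given by its set of realisations in 𝕄′.
  IsGaloisType : ∀ {n} → Pred ∣ 𝕄′ ∣ ℓ → Pred (Vector ∣ 𝕄′ ∣ n) ℓ → Set ℓ
  IsGaloisType X p = ∃ λ b₀ → ∀ b → p b ⇔ T′.SameGalois X b₀ b

  -- b ∈ p at A means that b realises p_A.  There is one p_A for each finite A,
  -- so the collection is maximal.
  record GlobalType (n : ℕ) : Set (lsuc ℓ) where
    field
      _at_       : ∀ {k} → Vector ∣ 𝕄 ∣ k → Pred (Vector ∣ 𝕄′ ∣ n) ℓ
      galois     : ∀ {k} (A : Vector ∣ 𝕄 ∣ k) → IsGaloisType ⟦ ι ∘ A ⟧ (_at_ A)
      compatible : ∀ {k m} (A : Vector ∣ 𝕄 ∣ k) (B : Vector ∣ 𝕄 ∣ m) →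
                   ⟦ A ⟧ ⊆ ⟦ B ⟧ → (b : Vector ∣ 𝕄 ∣ n) →
                   ι ∘ b ∈ _at_ B → ι ∘ b ∈ _at_ A
      realised   : ∃ λ b → ∀ {k} (A : Vector ∣ 𝕄 ∣ k) → b ∈ _at_ A

  open GlobalType public

  Realises : ∀ {n} → Vector ∣ 𝕄′ ∣ n → GlobalType n → Set ℓ
  Realises b p = ∀ {k} (A : Vector ∣ 𝕄 ∣ k) → b ∈ p at A

  ι[𝕄] : Pred ∣ 𝕄′ ∣ ℓ
  ι[𝕄] y = ∃ λ x → ι x ≡ y

  -- q m c i is a realisation of the type q_i^c.
  TypeFamily : ℕ → Set ℓ
  TypeFamily k = ∀ m → Vector ∣ 𝕄 ∣ m → ℕ → Vector ∣ 𝕄 ∣ (k + m)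

  _⊨⋁_ : ∀ {n} → Vector ∣ 𝕄 ∣ n → (ℕ → Vector ∣ 𝕄 ∣ n) → Set ℓ
  e ⊨⋁ q = ∃ λ i → T.SameType ∅ (q i) e

  -- bd realises q_c = t(bc/∅) iff ad realises ⋁ q_i^c.
  Describes : ∀ {n k} → TypeFamily k →
              Vector ∣ 𝕄′ ∣ n → Vector ∣ 𝕄 ∣ k → Set ℓ
  Describes q b a =
    ∀ m (c d : Vector ∣ 𝕄 ∣ m) →
    T′.SameType ∅ (b ++ (ι ∘ c)) (b ++ (ι ∘ d)) ⇔ ((a ++ d) ⊨⋁ q m c)

  E⟨_⟩ : ∀ {k} → TypeFamily k → Rel (Vector ∣ 𝕄 ∣ k) ℓ
  E⟨ q ⟩ a₀ a₁ =
    ∀ m (c d : Vector ∣ 𝕄 ∣ m) → ((a₀ ++ d) ⊨⋁ q m c) ⇔ ((a₁ ++ d) ⊨⋁ q m c)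

  module _ (𝓔 : Imaginaries 𝕄) where
    open Imaginaries 𝓔
    open Meq 𝓔

    -- The types q_i^c are not determined by b and a: adding to them types over
    -- ∅ incompatible with t(a/∅) keeps Describes q b a but may change E⟨ q ⟩,
    -- and the relations from all possible q need not be countably many.  So 𝓔
    -- contains E⟨ q ⟩ for one choice of q.  That a choice is possible is a
    -- premise here, not part of the assumption on 𝓔.
    StandingChoice : Set (lsuc ℓ)
    StandingChoice =
      ∀ {n k} (p : GlobalType n) (b : Vector ∣ 𝕄′ ∣ n) (a : Vector ∣ 𝕄 ∣ k) →
      Realises b p → ¬ T′.Splits b ι[𝕄] (ι ∘ a) →
      (∃ λ (q : TypeFamily k) → Describes q b a) →
      ∃ λ (q : TypeFamily k) → Describes q b a ×
        (∃ λ (s : Sort k) → ∀ a₀ a₁ → E s a₀ a₁ ⇔ E⟨ q ⟩ a₀ a₁)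

    -- f(p) = p
    Stabilises : ∀ {n} → AutEq → GlobalType n → Set ℓ
    Stabilises {n} f p =
      ∀ {k m} (A : Vector ∣ 𝕄 ∣ k) (B : Vector ∣ 𝕄 ∣ m) →
      (∀ j → ∃ λ i → B j ↦ A i) → (∀ i → ∃ λ j → B j ↦ A i) →
      (b b′ : Vector ∣ 𝕄 ∣ n) → (∀ i → b i ↦ b′ i) →
      ι ∘ b ∈ p at B → ι ∘ b′ ∈ p at A
      where open AutEq f

    IsCanonicalBase : ∀ {n} → 𝕄eq → GlobalType n → Set ℓ
    IsCanonicalBase α p =
      ∀ (f : AutEq) → Stabilises f p ⇔ (AutEq.⟨_⟩ f α ≈ α)

{-# OPTIONS --safe #-}

-- Let β ∈ 𝕄′ realise p.  By AIV, t(β/𝕄) does not split over some finite a ∈ 𝕄.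
-- Indeed, let player II win from (b, A), where b ∈ 𝕄 realises t(β/A), and let c, d
-- witness that t(β/𝕄) splits over A.  By AI some e ∈ 𝒜 realises t(c/A) = t(d/A),
-- and t(be/A) differs from t(βc/A) or from t(βd/A).  After conjugating β over A so
-- that this one of c, d becomes e, player I may move to a realisation of t(β/𝒜), and
-- the argument is repeated with fewer moves left for II.
--
-- There are only countably many types over ∅ (by LS and AI), so the types q_i^c
-- exist and give an E ∈ 𝓔; put α = a/E.  An automorphism f of 𝕄^eq restricts to
-- σ ∈ Aut(𝕄), which extends to τ ∈ Aut(𝕄′).  By the choice of q, the tuple σ(a)d
-- realises ⋁ q_i^c iff t(βc/∅) = t(τ(β)d/∅); hence (σ(a), a) ∈ E iff
-- t(β/𝕄) = t(τ(β)/𝕄), that is, iff f(p) = p.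

module Submission where

open import Defs
open import Axiom.ExcludedMiddle using (ExcludedMiddle)
open import Data.Bool.Properties using (T-irrelevant)
open import Data.Empty using (⊥; ⊥-elim)
open import Data.Fin using (Fin; zero; suc; toℕ; splitAt; _↑ˡ_; _↑ʳ_)
open import Data.Fin.Properties using (toℕ-injective)
open import Data.Nat using (ℕ; zero; suc; _+_)
open import Data.Nat.Properties using (+-suc; +-identityʳ; suc-injective)
open import Data.Product using (∃; _×_; _,_; proj₁; proj₂)
open import Data.Sum using (_⊎_; inj₁; inj₂; map; [_,_])
open import Data.Sum.Properties using (inj₁-injective; inj₂-injective)
open import Data.Vec.Functional using (Vector; []; _∷_; _++_)
open import Data.Vec.Functional.Properties using (lookup-++ˡ; lookup-++ʳ)
open import Function using (_∘_; id)
open import Function.Bundles using (_↣_; mk↣; _⇔_; mk⇔; module Injection; module Equivalence)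
open import Function.Construct.Composition using (_↣-∘_; _⇔-∘_)
open import Function.Construct.Identity using (⇔-id; ↣-id)
open import Function.Construct.Symmetry using (⇔-sym)
open import Level using (Lift; lift; lower) renaming (suc to lsuc)
open import Relation.Binary using (IsEquivalence)
open import Relation.Binary.PropositionalEquality using (_≡_; _≗_; refl; sym; trans; cong; subst)
open import Relation.Nullary using (¬_; Dec; yes; no; contradiction)
open import Relation.Nullary.Decidable using (True; toWitness; fromWitness)
open import Relation.Unary using (Pred; _∈_; _⊆_; ∅)
open Equivalence using () renaming (to to ⇒; from to ⇐)

-- Concatenation of finite tuples.

module _ {a b} {A : Set a} {B : Set b} (f : A → B) {m n : ℕ} where

  map-++⁺ : ∀ {xs : Vector A m} {ys : Vector A n} {xs′ ys′} →
            f ∘ xs ≗ xs′ → f ∘ ys ≗ ys′ → f ∘ (xs ++ ys) ≗ xs′ ++ ys′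
  map-++⁺ p q i with splitAt m i
  ... | inj₁ j = p j
  ... | inj₂ j = q j

  map-++⁻ : ∀ {xs : Vector A m} {ys : Vector A n} {xs′ ys′} →
            f ∘ (xs ++ ys) ≗ xs′ ++ ys′ → (f ∘ xs ≗ xs′) × (f ∘ ys ≗ ys′)
  map-++⁻ {xs} {ys} {xs′} {ys′} p =
    (λ i → trans (cong f (sym (lookup-++ˡ xs ys i)))
             (trans (p (i ↑ˡ n)) (lookup-++ˡ xs′ ys′ i))) ,
    (λ i → trans (cong f (sym (lookup-++ʳ xs ys i)))
             (trans (p (m ↑ʳ i)) (lookup-++ʳ xs′ ys′ i)))

module _ {a} {A : Set a} {m n : ℕ} {xs : Vector A m} {ys : Vector A n} where

  ++-∈ : ∀ {p} {P : Pred A p} → xs ∈ᵗ P → ys ∈ᵗ P → (xs ++ ys) ∈ᵗ P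
  ++-∈ p q i with splitAt m i
  ... | inj₁ j = p j
  ... | inj₂ j = q j

  ⊆-++ˡ : ⟦ xs ⟧ ⊆ ⟦ xs ++ ys ⟧
  ⊆-++ˡ (i , e) = i ↑ˡ n , trans (lookup-++ˡ xs ys i) e

  ⊆-++ʳ : ⟦ ys ⟧ ⊆ ⟦ xs ++ ys ⟧
  ⊆-++ʳ (i , e) = m ↑ʳ i , trans (lookup-++ʳ xs ys i) e

-- Countability: pairing, coding of tuples, images and enumerations.

pair-step : ℕ × ℕ → ℕ × ℕ
pair-step (zero  , y) = suc y , zero
pair-step (suc x , y) = x , suc y

-- Enumerates ℕ × ℕ along the antidiagonals.
unpair : ℕ → ℕ × ℕ
unpair zero    = zero , zero
unpair (suc n) = pair-step (unpair n)

-- The path is traced backwards: along an antidiagonal while `y` decreases, then from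
-- `(suc x , zero)` to `(zero , x)`, the end of the previous one, where `s` decreases.
unpair-diagonal : ∀ s y x → x + y ≡ s → ∃ λ n → unpair n ≡ (x , y)
unpair-diagonal s (suc y) x e =
  let n , p = unpair-diagonal s y (suc x) (trans (sym (+-suc x y)) e)
  in suc n , cong pair-step p
unpair-diagonal s zero zero e = zero , refl
unpair-diagonal (suc s) zero (suc x) e =
  let n , p = unpair-diagonal s x zero (trans (sym (+-identityʳ x)) (suc-injective e))
  in suc n , cong pair-step p

unpair-surjective : ∀ x y → ∃ λ n → unpair n ≡ (x , y)
unpair-surjective x y = unpair-diagonal (x + y) y x refl

untuple : ∀ m → ℕ → Vector ℕ m
untuple zero    _ = []
untuple (suc m) n = proj₁ (unpair n) ∷ untuple m (proj₂ (unpair n))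

untuple-surjective : ∀ m (v : Vector ℕ m) → ∃ λ n → untuple m n ≗ v
untuple-surjective zero    v = zero , λ ()
untuple-surjective (suc m) v =
  let k , p = untuple-surjective m (v ∘ suc)
      n , q = unpair-surjective (v zero) k
  in n , λ { zero    → cong proj₁ q
           ; (suc i) → trans (cong (λ z → untuple m (proj₂ z) i) q) (p i) }

section↣ : ∀ {a b} {A : Set a} {B : Set b} (f : A → B) →
           (∀ y → ∃ λ x → f x ≡ y) → B ↣ A
section↣ f s = mk↣ {to = proj₁ ∘ s} λ {y} {z} e →
  trans (sym (proj₂ (s y))) (trans (cong f e) (proj₂ (s z)))

unpair-⊎ : ℕ → ℕ ⊎ ℕ
unpair-⊎ n with unpair n
... | zero  , y = inj₁ y
... | suc _ , y = inj₂ y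

unpair-⊎-surjective : ∀ z → ∃ λ n → unpair-⊎ n ≡ z
unpair-⊎-surjective (inj₁ y) with n , e ← unpair-surjective 0 y = n , lem
  where
  lem : unpair-⊎ n ≡ inj₁ y
  lem rewrite e = refl
unpair-⊎-surjective (inj₂ y) with n , e ← unpair-surjective 1 y = n , lem
  where
  lem : unpair-⊎ n ≡ inj₂ y
  lem rewrite e = refl

countable-⊎ : ∀ {a b} {A : Set a} {B : Set b} →
              Countable A → Countable B → Countable (A ⊎ B)
countable-⊎ {A = A} {B} f g =
  section↣ unpair-⊎ unpair-⊎-surjective ↣-∘ mk↣ {to = h} h-injective
  where
  open Injection using (injective) renaming (to to code)
  h : A ⊎ B → ℕ ⊎ ℕ
  h = map (code f) (code g)
  h-injective : ∀ {x y} → h x ≡ h y → x ≡ y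
  h-injective {inj₁ x} {inj₁ y} e = cong inj₁ (injective f (inj₁-injective e))
  h-injective {inj₂ x} {inj₂ y} e = cong inj₂ (injective g (inj₂-injective e))

countable-Fin : ∀ {ℓ n} → Countable (Lift ℓ (Fin n))
countable-Fin = mk↣ {to = toℕ ∘ lower} λ e → cong lift (toℕ-injective e)

module Image (em : ∀ {e} → ExcludedMiddle e)
             {a b} {X : Set a} {A : Set b} (f : X → A) where

  -- Propositional membership makes the first projection injective.
  Image : Set b
  Image = ∃ λ y → True (em {P = ∃ λ x → f x ≡ y})

  image↣ : Image ↣ A
  image↣ = mk↣ {to = proj₁} λ { {y , t} {.y , t′} refl → cong (y ,_) (T-irrelevant t t′) }

  corestrict : X → Image
  corestrict x = f x , fromWitness (x , refl)

  image↣domain : Image ↣ X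
  image↣domain = mk↣ {to = preimage} λ {y} {z} e →
      Injection.injective image↣
        (trans (sym (proj₂ (toWitness (proj₂ y))))
          (trans (cong f e) (proj₂ (toWitness (proj₂ z)))))
    where
    preimage : Image → X
    preimage (y , t) = proj₁ (toWitness t)

enumerate : (∀ {e} → ExcludedMiddle e) → ∀ {a} {X : Set a} → Countable X → X →
            ∃ λ (e : ℕ → X) → ∀ x → ∃ λ n → e n ≡ x
enumerate em {X = X} c x₀ = e , λ x → code c x , surj x
  where
  open Injection using (injective) renaming (to to code)
  e : ℕ → X
  e n with em {P = ∃ λ x → code c x ≡ n}
  ... | yes (x , _) = x
  -- Numbers that code no element take the default value, which is why a point of `X` is required.
  ... | no _        = x₀
  surj : ∀ x → e (code c x) ≡ x
  surj x with em {P = ∃ λ y → code c y ≡ code c x}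
  ... | yes (y , p) = injective c p
  ... | no ¬p       = contradiction (x , refl) ¬p

-- The group of automorphisms of a structure.

module _ {ℓ} {L : Language ℓ} where

  idᵃ : (N : Structure L) → Aut N
  idᵃ N = record
    { to          = id
    ; isEmbedding = record
      { injective = id ; on-fun = λ _ _ → refl ; on-rel = λ _ _ → ⇔-id _ }
    ; surjective  = λ y → y , id
    }

module _ {ℓ} {L : Language ℓ} {N : Structure L} where

  open IsEmbedding

  infixr 9 _∘ᵃ_
  _∘ᵃ_ : Aut N → Aut N → Aut N
  σ ∘ᵃ τ = record
    { to          = to σ ∘ to τ
    ; isEmbedding = record
      { injective = injective (isEmbedding τ) ∘ injective (isEmbedding σ)
      ; on-fun    = λ F xs → trans (cong (to σ) (on-fun (isEmbedding τ) F xs))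
                                   (on-fun (isEmbedding σ) F (to τ ∘ xs))
      ; on-rel    = λ R xs →
          let module T = Equivalence (on-rel (isEmbedding τ) R xs)
              module S = Equivalence (on-rel (isEmbedding σ) R (to τ ∘ xs))
          in mk⇔ (S.to ∘ T.to) (T.from ∘ S.from)
      }
    ; surjective  = λ z →
        let y , p = surjective σ z
            x , q = surjective τ y
        in x , λ { refl → p (q refl) }
    }

  module _ (σ : Aut N) where

    private
      inv : ∣ N ∣ → ∣ N ∣
      inv y = proj₁ (surjective σ y)

      rightInv : ∀ y → to σ (inv y) ≡ y
      rightInv y = proj₂ (surjective σ y) refl

    infix 10 _⁻¹ᵃ
    _⁻¹ᵃ : Aut N
    _⁻¹ᵃ = record
      { to          = inv
      ; isEmbedding = record
        { injective = λ {x} {y} e →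
            trans (sym (rightInv x)) (trans (cong (to σ) e) (rightInv y))
        ; on-fun    = λ F xs → injective (isEmbedding σ)
            (trans (rightInv _)
              (trans (fun-cong N F (λ i → sym (rightInv (xs i))))
                (sym (on-fun (isEmbedding σ) F (inv ∘ xs)))))
        ; on-rel    = λ R xs →
            let module S = Equivalence (on-rel (isEmbedding σ) R (inv ∘ xs))
            in mk⇔ (S.from ∘ rel-resp N R (λ i → sym (rightInv (xs i))))
                   (rel-resp N R (λ i → rightInv (xs i)) ∘ S.to)
        }
      ; surjective  = λ x → to σ x , λ { refl →
          injective (isEmbedding σ) (rightInv (to σ x)) }
      }

    ⁻¹-inverseʳ : ∀ y → to σ (to _⁻¹ᵃ y) ≡ y
    ⁻¹-inverseʳ = rightInv

    ⁻¹-inverseˡ : ∀ x → to _⁻¹ᵃ (to σ x) ≡ x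
    ⁻¹-inverseˡ x = injective (isEmbedding σ) (rightInv (to σ x))

    ⁻¹-swap : ∀ {x y} → to σ x ≡ y → to _⁻¹ᵃ y ≡ x
    ⁻¹-swap refl = ⁻¹-inverseˡ _

-- Galois types, weak types and splitting under automorphisms.

module GaloisTypes {ℓ} {L : Language ℓ} (N : Structure L) where

  open Types N

  module _ {x} {X : Pred ∣ N ∣ x} {i} {I : Set i} where

    galois-refl : {a b : I → ∣ N ∣} → a ≗ b → SameGalois X a b
    galois-refl e = idᵃ N , (λ _ → refl) , e

    galois-sym : {a b : I → ∣ N ∣} → SameGalois X a b → SameGalois X b a
    galois-sym (σ , fix , e) =
      σ ⁻¹ᵃ , (λ y∈X → ⁻¹-swap σ (fix y∈X)) , λ j → ⁻¹-swap σ (e j)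

    galois-trans : {a b c : I → ∣ N ∣} →
                   SameGalois X a b → SameGalois X b c → SameGalois X a c
    galois-trans (σ , fixσ , e) (τ , fixτ , f) =
      τ ∘ᵃ σ , (λ y∈X → trans (cong (to τ) (fixσ y∈X)) (fixτ y∈X)) ,
      λ j → trans (cong (to τ) (e j)) (f j)

    galois-mono : ∀ {y} {Y : Pred ∣ N ∣ y} {a b : I → ∣ N ∣} → Y ⊆ X →
                  SameGalois X a b → SameGalois Y a b
    galois-mono Y⊆X (σ , fix , e) = σ , fix ∘ Y⊆X , e

    galois⇒type : {a b : I → ∣ N ∣} → SameGalois X a b → SameType X a b
    galois⇒type s B B∈X = galois-mono (λ { (i , refl) → B∈X i }) s

    -- If σ fixes `X` pointwise, then τστ⁻¹ fixes the image of `X` under τ, which contains `Y`.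
    galois-conjugate : ∀ (τ : Aut N) {y} {Y : Pred ∣ N ∣ y} {a b a′ b′ : I → ∣ N ∣} →
                       (∀ {z} → z ∈ Y → ∃ λ x → x ∈ X × to τ x ≡ z) →
                       to τ ∘ a ≗ a′ → to τ ∘ b ≗ b′ →
                       SameGalois X a b → SameGalois Y a′ b′
    galois-conjugate τ {Y = Y} Y⊆τX ea eb (σ , fix , e) =
      τ ∘ᵃ σ ∘ᵃ τ ⁻¹ᵃ , fixY ,
      λ j → trans (cong (to τ ∘ to σ) (⁻¹-swap τ (ea j)))
              (trans (cong (to τ) (e j)) (eb j))
      where
      fixY : Fixes (τ ∘ᵃ σ ∘ᵃ τ ⁻¹ᵃ) Y
      fixY z∈Y with x , x∈X , refl ← Y⊆τX z∈Y =
        cong (to τ) (trans (cong (to σ) (⁻¹-inverseˡ τ x)) (fix x∈X))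

  -- A finite set is among its own finite subsets. Over such sets the argument can therefore use
  -- Galois types, with explicit automorphisms as witnesses.
  type⇒galois : ∀ {k i} {I : Set i} (A : Vector ∣ N ∣ k) {a b : I → ∣ N ∣} →
                SameType ⟦ A ⟧ a b → SameGalois ⟦ A ⟧ a b
  type⇒galois A s = s A (λ i → i , refl)

  type⇒galois-∅ : ∀ {i} {I : Set i} {a b : I → ∣ N ∣} →
                  SameType ∅ a b → SameGalois ∅ a b
  type⇒galois-∅ s = galois-mono (λ ()) (s [] (λ ()))

  module _ {m k} {a b : Vector ∣ N ∣ m} {c d : Vector ∣ N ∣ k} where

    galois-++⁺ : ∀ {x} {X : Pred ∣ N ∣ x} (σ : Aut N) → Fixes σ X →
                 to σ ∘ a ≗ b → to σ ∘ c ≗ d → SameGalois X (a ++ c) (b ++ d)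
    galois-++⁺ σ fix p q = σ , fix , map-++⁺ (to σ) p q

  -- Fixing `c` pointwise means sending the tuple `c` to itself, so types over finite sets turn into
  -- types over ∅, the only ones occurring in `Describes` and `E⟨_⟩`.
  galois-absorb : ∀ {m k} {a b : Vector ∣ N ∣ m} {c : Vector ∣ N ∣ k} →
                  SameGalois ⟦ c ⟧ a b → SameGalois ∅ (a ++ c) (b ++ c)
  galois-absorb {c = c} (σ , fix , e) = galois-++⁺ σ (λ ()) e (λ i → fix (i , refl))

  galois-absorb⁻ : ∀ {m k} {a b : Vector ∣ N ∣ m} {c : Vector ∣ N ∣ k} →
                   SameGalois ∅ (a ++ c) (b ++ c) → SameGalois ⟦ c ⟧ a b
  galois-absorb⁻ (σ , _ , e) = let p , q = map-++⁻ (to σ) e in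
    σ , (λ { (i , refl) → q i }) , p

  -- The splitting witnesses move forward along θ, hence the closure of `B`; an equality of types
  -- between the moved tuples would move back along θ⁻¹.
  splits-transport : ∀ (θ : Aut N) {x n k} {a a′ : Vector ∣ N ∣ n} {A A′ : Vector ∣ N ∣ k}
                     {B : Pred ∣ N ∣ x} → (∀ {y} → y ∈ B → to θ y ∈ B) →
                     to θ ∘ a ≗ a′ → to θ ∘ A ≗ A′ → Splits a B A → Splits a′ B A′
  splits-transport θ {a = a} {a′} {A} {A′} B-closed ea eA
                   (m , b , c , b∈B , c∈B , b~c , ab≁ac) =
    m , to θ ∘ b , to θ ∘ c , B-closed ∘ b∈B , B-closed ∘ c∈B ,
    galois⇒type {X = ⟦ A′ ⟧} (galois-conjugate θ
      (λ { (i , refl) → A i , (i , refl) , eA i })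
      (λ _ → refl) (λ _ → refl) (type⇒galois A b~c)) ,
    λ same → ab≁ac (galois⇒type {X = ⟦ A ⟧} (galois-conjugate (θ ⁻¹ᵃ)
      (λ { (i , refl) → A′ i , (i , refl) , ⁻¹-swap θ (eA i) })
      (map-++⁺ (to (θ ⁻¹ᵃ)) (λ i → ⁻¹-swap θ (ea i)) (λ i → ⁻¹-inverseˡ θ (b i)))
      (map-++⁺ (to (θ ⁻¹ᵃ)) (λ i → ⁻¹-swap θ (ea i)) (λ i → ⁻¹-inverseˡ θ (c i)))
      (type⇒galois A′ same)))

-- Restricting automorphisms of 𝕄^eq to 𝕄.

module Restriction {ℓ} {L : Language ℓ} {𝕄 : Structure L} (𝓔 : Imaginaries 𝕄) where

  open Imaginaries 𝓔
  open Meq 𝓔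

  ≈-refl : ∀ {α} → α ≈ α
  ≈-refl {_ / s} = class (IsEquivalence.refl (equivalence s))

  ≈-sym : ∀ {α β} → α ≈ β → β ≈ α
  ≈-sym (class {s = s} e) = class (IsEquivalence.sym (equivalence s) e)

  ≈-trans : ∀ {α β γ} → α ≈ β → β ≈ γ → α ≈ γ
  ≈-trans (class {s = s} e) (class e′) =
    class (IsEquivalence.trans (equivalence s) e e′)

  class⁻ : ∀ {n} {s : Sort n} {a b} → (a / s) ≈ (b / s) → E s a b
  class⁻ (class e) = e

  real-injective : ∀ {x y} → real x ≈ real y → x ≡ y
  real-injective e = ⇒ E-equality (class⁻ e)

  P-equality : ∀ {α} → P equality α → ∃ λ x → α ≈ real x
  P-equality (a , e) = a zero , ≈-trans e (class (⇐ E-equality refl))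

  P-real : ∀ {α x} → α ≈ real x → P equality α
  P-real e = _ , e

  module _ (f : AutEq) where

    open AutEq f using (⟨_⟩; _↦_)
    private module F = AutEq f

    private
      image : ∀ x → ∃ λ y → x ↦ y
      image x = P-equality (⇒ (F.on-P equality (real x)) (P-real ≈-refl))

      ↦-functional : ∀ {x y z} → x ↦ y → x ↦ z → y ≡ z
      ↦-functional p q = real-injective (≈-trans (≈-sym p) q)

      preimage : ∀ y → ∃ λ x → x ↦ y
      preimage y =
        let α , fα≈y = F.surjective (real y)
            x , α≈x = P-equality (⇐ (F.on-P equality α) (P-real fα≈y))
        in x , ≈-trans (F.cong (≈-sym α≈x)) fα≈y

    -- The real elements are exactly those of `P equality`, which `f` preserves in both directions;
    -- on them `≈` is equality, so `↦` is the graph of a bijection.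
    restrict : Aut 𝕄
    restrict = record
      { to          = proj₁ ∘ image
      ; isEmbedding = record
        { injective = λ {x} {y} e → real-injective (F.injective
            (≈-trans (subst (x ↦_) e (proj₂ (image x))) (≈-sym (proj₂ (image y)))))
        ; on-fun    = λ G xs →
            ↦-functional (proj₂ (image _)) (F.on-fun G (λ i → proj₂ (image (xs i))))
        ; on-rel    = λ R xs → F.on-rel R (λ i → proj₂ (image (xs i)))
        }
      ; surjective  = λ y → let x , x↦y = preimage y in
          x , λ { refl → ↦-functional (proj₂ (image x)) x↦y }
      }

    restrict⇒↦ : ∀ {x y} → to restrict x ≡ y → x ↦ y
    restrict⇒↦ refl = proj₂ (image _)

    ↦⇒restrict : ∀ {x y} → x ↦ y → to restrict x ≡ y
    ↦⇒restrict = ↦-functional (proj₂ (image _))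

    -- By `on-F`, `f` sends `a / s` to the class of the image of `a` under `restrict f`.
    E⇔fixes : ∀ {n} (s : Sort n) a → E s (to restrict ∘ a) a ⇔ ⟨_⟩ (a / s) ≈ (a / s)
    E⇔fixes s a = mk⇔ (≈-trans fa ∘ class) (class⁻ ∘ ≈-trans (≈-sym fa))
      where
      fa : ⟨_⟩ (a / s) ≈ ((to restrict ∘ a) / s)
      fa = F.on-F s (λ i → restrict⇒↦ refl)

-- Countable models, and the passage between 𝕄′ and 𝕄.

module Monsters
  (em : ∀ {e} → ExcludedMiddle e) {ℓ} {L : Language ℓ} (𝒦 : AEC L)
  (δ : Set ℓ) (ω<δ : ℕ <ᶜ δ)
  (𝕄 : Structure L) (monster : IsMonster 𝒦 δ 𝕄) (fur : Models.IsFUR 𝒦 δ 𝕄)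
  (𝕄′ : Structure L) (ι : ∣ 𝕄 ∣ → ∣ 𝕄′ ∣) (super : IsSupermonster 𝒦 𝕄 𝕄′ ι)
  where

  open AEC 𝒦
  open Models 𝒦 δ 𝕄
  open IsFUR fur
  open IsMonster monster
  open IsSupermonster super renaming (strong to ι-strong)
  open GaloisTypes 𝕄
  open GaloisTypes 𝕄′ using () renaming
    (galois-refl to galois-refl′; galois-sym to galois-sym′; galois-trans to galois-trans′;
     galois-mono to galois-mono′; galois⇒type to galois⇒type′; type⇒galois to type⇒galois′;
     type⇒galois-∅ to type⇒galois-∅′;
     galois-absorb to galois-absorb′; galois-absorb⁻ to galois-absorb⁻′;
     galois-conjugate to galois-conjugate′;
     galois-++⁺ to galois-++⁺′; splits-transport to splits-transport′)

  module M  = Types 𝕄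
  module M′ = Types 𝕄′

  strong-resp-≗ : ∀ {A B : Structure L} {f g} → f ≗ g → Strong A B f → Strong A B g
  strong-resp-≗ = strong-iso (idᵃ _) (idᵃ _)

  -- `LS≡ω` asks for an injective family, so it is applied to the image of `x`; a countable image
  -- plus ω bounds the size of `B`.
  countable-family-in-model :
    ∀ {A} → K A → {X : Set ℓ} → Countable X → (x : X → ∣ A ∣) →
    ∃ λ B → ∃ λ j → Strong B A j × Countable ∣ B ∣ ×
      ∃ λ (x̂ : X → ∣ B ∣) → j ∘ x̂ ≗ x
  countable-family-in-model KA {X} cX x =
    let B , j , j-strong , B↣ , covers = proj₂ LS≡ω KA Image image↣
    in B , j , j-strong , countable-⊎ (cX ↣-∘ image↣domain) (↣-id ℕ) ↣-∘ B↣ ,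
       proj₁ ∘ covers ∘ corestrict , λ y → proj₂ (covers (corestrict y))
    where
    open Image em x

  countable⇒<δ : ∀ {a} {X : Set a} → Countable X → X <ᶜ δ
  countable⇒<δ cX =
    proj₁ ω<δ ↣-∘ cX , λ δ↣X → proj₂ ω<δ (cX ↣-∘ δ↣X)

  -- A countable D ≼ 𝕄′ containing a given countable family embeds into 𝕄 over
  -- a given countable C ≼ 𝕄.
  record Reflection {C : Set ℓ} (i : C → ∣ 𝕄 ∣)
                    {X : Set ℓ} (x : X → ∣ 𝕄′ ∣) : Set (lsuc (lsuc ℓ)) where
    field
      D        : Structure L
      j        : ∣ D ∣ → ∣ 𝕄′ ∣
      h        : ∣ D ∣ → ∣ 𝕄 ∣
      j-strong : Strong D 𝕄′ j
      h-strong : Strong D 𝕄 h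
      ĉ        : C → ∣ D ∣
      j∘ĉ      : j ∘ ĉ ≗ ι ∘ i
      h∘ĉ      : h ∘ ĉ ≗ i
      x̂        : X → ∣ D ∣
      j∘x̂      : j ∘ x̂ ≗ x

  -- Löwenheim-Skolem gives `D` around ι(C) and `x`, and coherence makes C → D strong. Universality
  -- then embeds `D` into 𝕄, and homogeneity of 𝕄 corrects the embedding on `C`.
  reflection : ∀ {C i} → Strong C 𝕄 i → Countable ∣ C ∣ →
               ∀ {X : Set ℓ} → Countable X → (x : X → ∣ 𝕄′ ∣) → Reflection i x
  reflection {C} {i} i-strong cC cX x =
    let D , j , j-strong , cD , l , j∘l =
          countable-family-in-model (IsMonster.inK isMonster)
            (countable-⊎ cC cX) [ ι ∘ i , x ]
        k-strong = coherence j-strong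
          (strong-resp-≗ (λ z → sym (j∘l (inj₁ z))) (strong-∘ i-strong ι-strong))
        g , g-strong = universal D (proj₁ (strong⇒K j-strong)) (countable⇒<δ cD)
        σ , e = homogeneous C (countable⇒<δ cC) (g ∘ l ∘ inj₁) i
                  (strong-∘ k-strong g-strong) i-strong
    in record
      { j-strong = j-strong
      ; h-strong = strong-iso (idᵃ D) σ (λ _ → refl) g-strong
      ; ĉ = l ∘ inj₁ ; j∘ĉ = j∘l ∘ inj₁ ; h∘ĉ = e
      ; x̂ = l ∘ inj₂ ; j∘x̂ = j∘l ∘ inj₂ }

  -- After reflecting a countable `D` containing `β` over 𝒜, the maps `ι ∘ h` and `j` are two strong
  -- embeddings of `D` into 𝕄′, conjugate by homogeneity of 𝕄′.
  realise : ∀ 𝒜 → CountableModel 𝒜 → ∀ {n} (β : Vector ∣ 𝕄′ ∣ n) →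
            ∃ λ (b : Vector ∣ 𝕄 ∣ n) → ∃ λ (τ : Aut 𝕄′) →
              (∀ {x} → x ∈ ∥ 𝒜 ∥ → to τ (ι x) ≡ ι x) × (to τ ∘ ι ∘ b ≗ β)
  realise 𝒜 c𝒜 β =
    h ∘ x̂ ∘ lift , τ ,
    (λ { (y , refl) → trans (cong (to τ ∘ ι) (sym (h∘ĉ y))) (trans (τ-over (ĉ y)) (j∘ĉ y)) }) ,
    λ y → trans (τ-over (x̂ (lift y))) (j∘x̂ (lift y))
    where
    open Reflection (reflection (strong 𝒜) c𝒜 countable-Fin (β ∘ lower))
    open IsEmbedding (strong⇒embedding h-strong) using (injective)
    D<𝕄′ : ∣ D ∣ <ᶜ ∣ 𝕄′ ∣
    D<𝕄′ = proj₁ larger ↣-∘ mk↣ injective ,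
           λ 𝕄′↣D → proj₂ larger (mk↣ injective ↣-∘ 𝕄′↣D)
    lifted = IsMonster.homogeneous isMonster D D<𝕄′ (ι ∘ h) j
               (strong-∘ h-strong ι-strong) j-strong
    τ : Aut 𝕄′
    τ = proj₁ lifted
    τ-over : to τ ∘ ι ∘ h ≗ j
    τ-over = proj₂ lifted

  countable-model : ∀ {X : Set ℓ} → Countable X → (x : X → ∣ 𝕄 ∣) →
                    ∃ λ 𝒜 → CountableModel 𝒜 × (∀ y → x y ∈ ∥ 𝒜 ∥)
  countable-model cX x =
    let B , j , j-strong , cB , x̂ , e = countable-family-in-model inK cX x
    in record { strong = j-strong ; small = countable⇒<δ cB } , cB ,
       λ y → x̂ y , e y

  galois-lift : ∀ {n k} {a b : Vector ∣ 𝕄 ∣ n} (A : Vector ∣ 𝕄 ∣ k) →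
                M.SameGalois ⟦ A ⟧ a b → M′.SameGalois ⟦ ι ∘ A ⟧ (ι ∘ a) (ι ∘ b)
  galois-lift A (σ , fix , e) =
    let τ , τ∘ι = extends σ in
    τ , (λ { (i , refl) → trans (τ∘ι (A i)) (cong ι (fix (i , refl))) }) ,
    λ i → trans (τ∘ι _) (cong ι (e i))

  -- An automorphism τ of 𝕄′ need not preserve 𝕄. Instead, a countable 𝒞 containing all the tuples
  -- is fixed, and a `D` containing 𝒞 and τ(𝒞) is reflected over 𝒞; the resulting strong map 𝒞 → 𝕄
  -- extends to σ.
  galois-reflect : ∀ {n k} {a b : Vector ∣ 𝕄 ∣ n} (A : Vector ∣ 𝕄 ∣ k) →
                   M′.SameGalois ⟦ ι ∘ A ⟧ (ι ∘ a) (ι ∘ b) → M.SameGalois ⟦ A ⟧ a b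
  galois-reflect {n} {k} {a} {b} A (τ , fix , e) =
    σ , (λ { (z , refl) → σ-sends (∈𝒞 (inj₂ (lift z))) (∈𝒞 (inj₂ (lift z)))
                            (fix (z , refl)) }) ,
    λ z → σ-sends (∈𝒞 (inj₁ (inj₁ (lift z)))) (∈𝒞 (inj₁ (inj₂ (lift z)))) (e z)
    where
    Index = (Lift ℓ (Fin n) ⊎ Lift ℓ (Fin n)) ⊎ Lift ℓ (Fin k)
    family : Index → ∣ 𝕄 ∣
    family = [ [ a ∘ lower , b ∘ lower ] , A ∘ lower ]
    found = countable-model
      (countable-⊎ (countable-⊎ countable-Fin countable-Fin) countable-Fin) family
    𝒞 : Model
    𝒞 = proj₁ found
    c𝒞 : CountableModel 𝒞
    c𝒞 = proj₁ (proj₂ found)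
    ∈𝒞 : ∀ y → family y ∈ ∥ 𝒞 ∥
    ∈𝒞 = proj₂ (proj₂ found)
    open Reflection (reflection (strong 𝒞) c𝒞 c𝒞 (to τ ∘ ι ∘ incl 𝒞))
    x̂-strong : Strong (str 𝒞) D x̂
    x̂-strong = coherence j-strong (strong-resp-≗ (sym ∘ j∘x̂)
      (strong-iso (idᵃ _) τ (λ _ → refl) (strong-∘ (strong 𝒞) ι-strong)))
    extended = homogeneous (str 𝒞) (small 𝒞) (incl 𝒞) (h ∘ x̂) (strong 𝒞)
                 (strong-∘ x̂-strong h-strong)
    σ : Aut 𝕄
    σ = proj₁ extended
    σ-sends : ∀ {y z} → y ∈ ∥ 𝒞 ∥ → z ∈ ∥ 𝒞 ∥ → to τ (ι y) ≡ ι z → to σ y ≡ z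
    σ-sends (y , refl) (z , refl) τy≡z =
      trans (proj₂ extended y) (trans (cong h x̂≡ĉ) (h∘ĉ z))
      where
      x̂≡ĉ : x̂ y ≡ ĉ z
      x̂≡ĉ = IsEmbedding.injective (strong⇒embedding j-strong)
              (trans (j∘x̂ y) (trans τy≡z (sym (j∘ĉ z))))

  -- Finite bases of non-splitting, from the game `GI`.

  open Global 𝕄 𝕄′ ι

  -- If σ(e) = y, then `β` together with ι(y) is conjugate to `pull σ β` together with ι(e); a
  -- parameter outside a countable model can thus be traded for one inside.
  pull : ∀ {n} → Aut 𝕄 → Vector ∣ 𝕄′ ∣ n → Vector ∣ 𝕄′ ∣ n
  pull σ β = to (proj₁ (extends σ) ⁻¹ᵃ) ∘ β

  pull-type : ∀ {n k} {A : Vector ∣ 𝕄 ∣ k} (σ : Aut 𝕄) → M.Fixes σ ⟦ A ⟧ →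
              (β : Vector ∣ 𝕄′ ∣ n) → M′.SameGalois ⟦ ι ∘ A ⟧ β (pull σ β)
  pull-type σ fix β =
    let τ , τ∘ι = extends σ in
    τ ⁻¹ᵃ , (λ { (i , refl) → ⁻¹-swap τ (trans (τ∘ι _) (cong ι (fix (i , refl)))) }) ,
    λ _ → refl

  -- Used contrapositively: a base `B` of non-splitting for `pull σ β` yields the base σ(B) for `β`.
  pull-splits : ∀ {n k} {A : Vector ∣ 𝕄 ∣ k} (σ : Aut 𝕄) {β : Vector ∣ 𝕄′ ∣ n} →
                M′.Splits β ι[𝕄] (ι ∘ to σ ∘ A) → M′.Splits (pull σ β) ι[𝕄] (ι ∘ A)
  pull-splits σ = let τ , τ∘ι = extends σ in
    splits-transport′ (τ ⁻¹ᵃ) {B = ι[𝕄]}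
      (λ { (x , refl) → to (σ ⁻¹ᵃ) x ,
           sym (⁻¹-swap τ (trans (τ∘ι _) (cong ι (⁻¹-inverseʳ σ x)))) })
      (λ _ → refl) (λ _ → ⁻¹-swap τ (τ∘ι _))

  NonSplittingBase : ∀ {n} → Vector ∣ 𝕄′ ∣ n → Set ℓ
  NonSplittingBase β =
    ∃ λ k → ∃ λ (A : Vector ∣ 𝕄 ∣ k) → ¬ M′.Splits β ι[𝕄] (ι ∘ A)

  -- The game takes place in 𝕄, so a position holds a tuple `b` of 𝕄 that agrees with `β` only over
  -- the current `A`. In the mutual recursion with `after-move`, `r` drops with each answer of
  -- player II.
  base-or-move : ∀ r 𝒜 → CountableModel 𝒜 →
    ∀ {n k} (A : Vector ∣ 𝕄 ∣ k) → A ∈ᵗ ∥ 𝒜 ∥ →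
    (b : Vector ∣ 𝕄 ∣ n) (β : Vector ∣ 𝕄′ ∣ n) → M′.SameGalois ⟦ ι ∘ A ⟧ (ι ∘ b) β →
    M.IIWins r ∥ 𝒜 ∥ b A → NonSplittingBase β

  -- Player I moves to `b*`, which agrees with `β` over all of 𝒜, whereas `b` does so over `A` but
  -- not over `A′`; hence the move is legal. For `r` zero this contradicts `wins`, and otherwise
  -- `b*` still agrees with `β` over any answer of player II.
  after-move : ∀ r 𝒜 → CountableModel 𝒜 →
    ∀ {n k k′} (A : Vector ∣ 𝕄 ∣ k) (A′ : Vector ∣ 𝕄 ∣ k′) →
    A ∈ᵗ ∥ 𝒜 ∥ → A′ ∈ᵗ ∥ 𝒜 ∥ → ⟦ A ⟧ ⊆ ⟦ A′ ⟧ →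
    (b : Vector ∣ 𝕄 ∣ n) (β : Vector ∣ 𝕄′ ∣ n) → M′.SameGalois ⟦ ι ∘ A ⟧ (ι ∘ b) β →
    ¬ M′.SameGalois ⟦ ι ∘ A′ ⟧ (ι ∘ b) β →
    M.IIWins r ∥ 𝒜 ∥ b A → NonSplittingBase β
  after-move r 𝒜 c𝒜 A A′ A∈𝒜 A′∈𝒜 A⊆A′ b β b~β b≁β wins =
    play r wins
    where
    found = realise 𝒜 c𝒜 β
    b* = proj₁ found
    b*~β : ∀ {m} (X : Vector ∣ 𝕄 ∣ m) → X ∈ᵗ ∥ 𝒜 ∥ →
           M′.SameGalois ⟦ ι ∘ X ⟧ (ι ∘ b*) β
    b*~β X X∈𝒜 = let θ , fix , e = proj₂ found in
      θ , (λ { (i , refl) → fix (X∈𝒜 i) }) , e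
    legal : M.LegalMove ∥ 𝒜 ∥ b A b* A′
    legal = A′∈𝒜 ,
      galois⇒type (galois-reflect A (galois-trans′ (b*~β A A∈𝒜) (galois-sym′ b~β))) ,
      A⊆A′ ,
      λ same → b≁β (galois-trans′
        (galois-sym′ (galois-lift A′ (type⇒galois A′ same))) (b*~β A′ A′∈𝒜))
    play : ∀ r → M.IIWins r ∥ 𝒜 ∥ b A → NonSplittingBase β
    play zero    wins = contradiction legal (wins b* A′)
    play (suc r) wins = let _ , A″ , A″∈𝒜 , _ , wins″ = wins b* A′ legal in
      base-or-move r 𝒜 c𝒜 A″ A″∈𝒜 b* β (b*~β A″ A″∈𝒜) wins″

  base-or-move r 𝒜 c𝒜 {n} A A∈𝒜 b β b~β wins with em {P = M′.Splits β ι[𝕄] (ι ∘ A)}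
  ... | no ¬splits = _ , A , ¬splits
  ... | yes (m , c , d , c∈𝕄 , d∈𝕄 , c~d , βc≁βd) = choose em
    where
    c₀ d₀ : Vector ∣ 𝕄 ∣ m
    c₀ = proj₁ ∘ c∈𝕄
    d₀ = proj₁ ∘ d∈𝕄
    c₀~d₀ : M.SameGalois ⟦ A ⟧ c₀ d₀
    c₀~d₀ = galois-reflect A
      (galois-trans′ (galois-refl′ (proj₂ ∘ c∈𝕄))
        (galois-trans′ (type⇒galois′ (ι ∘ A) c~d)
          (galois-refl′ (sym ∘ proj₂ ∘ d∈𝕄))))
    -- Player I may name only parameters from 𝒜, while `c₀` and `d₀` may lie outside it.
    saturated = AI 𝒜 c𝒜 c₀ A A∈𝒜
    e = proj₁ saturated
    e~c₀ : M.SameGalois ⟦ A ⟧ e c₀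
    e~c₀ = type⇒galois A (proj₂ (proj₂ saturated))
    e~d₀ : M.SameGalois ⟦ A ⟧ e d₀
    e~d₀ = galois-trans e~c₀ c₀~d₀
    A′ = A ++ e
    Matches : Aut 𝕄 → Set ℓ
    Matches σ = M′.SameGalois ⟦ ι ∘ A′ ⟧ (ι ∘ b) (pull σ β)
    -- If b had the type over A e of β conjugated along both c ↦ e and d ↦ e,
    -- then βc and βd would have the same type over A.
    not-both : Matches (proj₁ e~c₀) → Matches (proj₁ e~d₀) → ⊥
    not-both b~β₁ b~β₂ = βc≁βd (galois⇒type′
      (galois-trans′ (pull-++ e~c₀ (proj₂ ∘ c∈𝕄))
        (galois-trans′ (θ , fix ∘ ι∘⊆ ⊆-++ˡ , map-++⁺ (to θ) θβ₁≗β₂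
            (λ i → fix (ι∘⊆ (⊆-++ʳ {xs = A}) (i , refl))))
          (galois-sym′ (pull-++ e~d₀ (proj₂ ∘ d∈𝕄))))))
      where
      β₁~β₂ = galois-trans′ (galois-sym′ b~β₁) b~β₂
      θ = proj₁ β₁~β₂
      fix = proj₁ (proj₂ β₁~β₂)
      θβ₁≗β₂ = proj₂ (proj₂ β₁~β₂)
      ι∘⊆ : ∀ {l} {B : Vector ∣ 𝕄 ∣ l} → ⟦ B ⟧ ⊆ ⟦ A′ ⟧ → ⟦ ι ∘ B ⟧ ⊆ ⟦ ι ∘ A′ ⟧
      ι∘⊆ B⊆A′ (i , refl) = let j , p = B⊆A′ (i , refl) in j , cong ι p
      -- Both `c` and `d` are replaced by the same `e`, which `θ` fixes along with `A`, so `θ` links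
      -- the two conjugates.
      pull-++ : ∀ {y x} (s : M.SameGalois ⟦ A ⟧ e y) → ι ∘ y ≗ x →
                M′.SameGalois ⟦ ι ∘ A ⟧ (β ++ x) (pull (proj₁ s) β ++ (ι ∘ e))
      pull-++ (σ , fixσ , σe≗y) ιy≗x =
        let τ , fixτ , _ = pull-type σ fixσ β in
        galois-++⁺′ τ fixτ (λ _ → refl) (λ i → ⁻¹-swap (proj₁ (extends σ))
          (trans (proj₂ (extends σ) (e i)) (trans (cong ι (σe≗y i)) (ιy≗x i))))
    move : ∀ {y} (s : M.SameGalois ⟦ A ⟧ e y) → ¬ Matches (proj₁ s) → NonSplittingBase β
    move (σ , fix , _) ¬matches =
      let k , B , ¬splits = after-move r 𝒜 c𝒜 A A′ A∈𝒜
            (++-∈ {P = ∥ 𝒜 ∥} A∈𝒜 (proj₁ (proj₂ saturated))) ⊆-++ˡ b (pull σ β)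
            (galois-trans′ b~β (pull-type σ fix β)) ¬matches wins
      in k , to σ ∘ B , ¬splits ∘ pull-splits σ
    choose : Dec (Matches (proj₁ e~c₀)) → NonSplittingBase β
    choose (no ¬matches) = move e~c₀ ¬matches
    choose (yes matches) = move e~d₀ (not-both matches)

  -- `AIV` concerns tuples of 𝕄, so `β` is replaced by a `b` conjugate to it over an arbitrary
  -- countable model; the game starts from the empty set.
  nonSplittingBase : ∀ {n} (β : Vector ∣ 𝕄′ ∣ n) → NonSplittingBase β
  nonSplittingBase β =
    let 𝒜 , c𝒜 , _ = countable-model (countable-Fin {n = 0}) (λ { (lift ()) })
        b , τ , _ , e = realise 𝒜 c𝒜 β
        r , wins = AIV b
    in base-or-move r 𝒜 c𝒜 [] (λ ()) b β (τ , (λ ()) , e) (wins 𝒜 c𝒜 [] (λ ()))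

  -- Types over ∅ and the families q_i^c.

  -- By `AI` with no parameters, the tuples of a single countable model realise every type over ∅.
  countably-many-types : ∀ n → ∃ λ (e : ℕ → Vector ∣ 𝕄 ∣ n) →
                         ∀ x → ∃ λ i → M.SameGalois ∅ (e i) x
  countably-many-types n =
    let 𝒜 , c𝒜 , _ = countable-model (countable-Fin {n = 0}) (λ { (lift ()) })
        e , e-surjective = enumerate em c𝒜 (point 𝒜)
    in (λ i → incl 𝒜 ∘ e ∘ untuple n i) , λ x →
       let a , a∈𝒜 , a~x = AI 𝒜 c𝒜 x [] (λ ())
           i , p = untuple-surjective n (λ l → proj₁ (e-surjective (proj₁ (a∈𝒜 l))))
       in i , galois-trans
         (galois-refl (λ l → trans (cong (incl 𝒜)
            (trans (cong e (p l)) (proj₂ (e-surjective (proj₁ (a∈𝒜 l))))))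
            (proj₂ (a∈𝒜 l))))
         (galois-mono (λ ()) (type⇒galois [] a~x))
    where
    point : ∀ 𝒜 → ∣ str 𝒜 ∣
    point 𝒜 with em {P = ∣ str 𝒜 ∣}
    ... | yes x = x
    -- An empty carrier would inject into `Fin 0`.
    ... | no ¬x = contradiction (mk↣ {to = λ x → ⊥-elim (¬x x)} λ {x} → ⊥-elim (¬x x))
                    (noFinite (proj₁ (strong⇒K (strong 𝒜))) 0)

  -- Non-splitting makes t(βd/∅) a function of t(ad/∅). So q^c may list the types t(ad/∅) over those
  -- d with t(βd/∅) = t(βc/∅).
  describable : ∀ {n k} (β : Vector ∣ 𝕄′ ∣ n) (a : Vector ∣ 𝕄 ∣ k) →
                ¬ M′.Splits β ι[𝕄] (ι ∘ a) → ∃ λ (q : TypeFamily k) → Describes q β a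
  describable {k = k} β a ¬splits =
    q , λ m c d → mk⇔ (described m c d) (described⁻ m c d)
    where
    invariant : ∀ {m} {d d′ : Vector ∣ 𝕄 ∣ m} → M.SameGalois ∅ (a ++ d) (a ++ d′) →
                M′.SameGalois ∅ (β ++ (ι ∘ d)) (β ++ (ι ∘ d′))
    invariant {m} {d} {d′} (σ , _ , e)
      with em {P = M′.SameType ⟦ ι ∘ a ⟧ (β ++ (ι ∘ d)) (β ++ (ι ∘ d′))}
    ... | yes same = galois-mono′ (λ ()) (type⇒galois′ (ι ∘ a) same)
    ... | no ¬same = ⊥-elim (¬splits
      (m , ι ∘ d , ι ∘ d′ , (λ i → d i , refl) , (λ i → d′ i , refl) ,
       galois⇒type′ (galois-lift a
         (let p , r = map-++⁻ (to σ) e in σ , (λ { (i , refl) → p i }) , r)) ,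
       ¬same))
    Good : ∀ m (c : Vector ∣ 𝕄 ∣ m) → Vector ∣ 𝕄 ∣ (k + m) → Set ℓ
    Good m c x = ∃ λ d → M.SameGalois ∅ x (a ++ d) ×
                   M′.SameGalois ∅ (β ++ (ι ∘ c)) (β ++ (ι ∘ d))
    -- A family needs a value at every index, so list entries that are not `Good` are replaced by
    -- `a ++ c`, which always is.
    choose : ∀ m c x → ∃ λ y → Good m c y × (Good m c x → y ≡ x)
    choose m c x with em {P = Good m c x}
    ... | yes good = x , good , λ _ → refl
    ... | no ¬good =
      a ++ c , (c , galois-refl (λ _ → refl) , galois-refl′ (λ _ → refl)) ,
      λ good → contradiction good ¬good
    chosen = λ m c i → choose m c (proj₁ (countably-many-types (k + m)) i)
    q : TypeFamily k
    q m c i = proj₁ (chosen m c i)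
    good-q : ∀ m c i → Good m c (q m c i)
    good-q m c i = proj₁ (proj₂ (chosen m c i))
    q-good : ∀ m c i → Good m c _ → q m c i ≡ _
    q-good m c i = proj₂ (proj₂ (chosen m c i))
    described : ∀ m (c d : Vector ∣ 𝕄 ∣ m) →
                M′.SameType ∅ (β ++ (ι ∘ c)) (β ++ (ι ∘ d)) → (a ++ d) ⊨⋁ q m c
    described m c d same =
      let i , e~ad = proj₂ (countably-many-types (k + m)) (a ++ d)
      in i , galois⇒type (subst (λ x → M.SameGalois ∅ x (a ++ d))
           (sym (q-good m c i (d , e~ad , type⇒galois-∅′ same))) e~ad)
    described⁻ : ∀ m (c d : Vector ∣ 𝕄 ∣ m) →
                 (a ++ d) ⊨⋁ q m c → M′.SameType ∅ (β ++ (ι ∘ c)) (β ++ (ι ∘ d))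
    described⁻ m c d (i , q~ad) =
      let d′ , q~ad′ , βc~βd′ = good-q m c i
      in galois⇒type′ (galois-trans′ βc~βd′
           (invariant (galois-trans (galois-sym q~ad′) (type⇒galois-∅ q~ad))))

  ⊨⋁-resp : ∀ {l} {e e′ : Vector ∣ 𝕄 ∣ l} {r} → M.SameGalois ∅ e e′ →
            e ⊨⋁ r → e′ ⊨⋁ r
  ⊨⋁-resp e~e′ (i , r~e) =
    i , galois⇒type (galois-trans (type⇒galois-∅ r~e) e~e′)

  -- The class of `a` as canonical base.

  module CanonicalBases (𝓔 : Imaginaries 𝕄) where

    open Restriction 𝓔
    open Meq 𝓔

    module _ {n} (p : GlobalType n) {β : Vector ∣ 𝕄′ ∣ n} (β⊨p : Realises β p) where

      -- Both `β` and `b` are compared with the realisation `b₀` presenting p_A; this replaces `p`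
      -- by the type of `β`.
      at⇔ : ∀ {k} (A : Vector ∣ 𝕄 ∣ k) {b} → b ∈ p at A ⇔ M′.SameGalois ⟦ ι ∘ A ⟧ β b
      at⇔ A {b} = let b₀ , iff = galois p A in mk⇔
        (λ b∈p → galois-trans′ (galois-sym′ (⇒ (iff β) (β⊨p A))) (⇒ (iff b) b∈p))
        (λ β~b → ⇐ (iff b) (galois-trans′ (⇒ (iff β) (β⊨p A)) β~b))

      TypeInvariant : AutEq → Set ℓ
      TypeInvariant f = ∀ {m} (c : Vector ∣ 𝕄 ∣ m) →
        M′.SameGalois ⟦ ι ∘ c ⟧ β (to (proj₁ (extends (restrict f))) ∘ β)

      module _ (f : AutEq) where

        private
          σ : Aut 𝕄
          σ = restrict f
          τ : Aut 𝕄′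
          τ = proj₁ (extends σ)
          τ∘ι : to τ ∘ ι ≗ ι ∘ to σ
          τ∘ι = proj₂ (extends σ)

        -- `Stabilises` tests only realisations in 𝕄. To reach τ(β), a `b` in 𝕄 with the type of `β`
        -- over σ⁻¹(c) is used: σ(b) realises p_c by stability, and has the type of τ(β) over `c` by
        -- conjugation.
        stabilises⇔invariant : Stabilises 𝓔 f p ⇔ TypeInvariant f
        stabilises⇔invariant = mk⇔ invariant stabilises
          where
          invariant : Stabilises 𝓔 f p → TypeInvariant f
          invariant stable {m} c = galois-trans′ (⇒ (at⇔ c) σb∈p) σb~τβ
            where
            B : Vector ∣ 𝕄 ∣ m
            B = to (σ ⁻¹ᵃ) ∘ c
            found = countable-model countable-Fin (B ∘ lower)
            realised-in = realise (proj₁ found) (proj₁ (proj₂ found)) β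
            b : Vector ∣ 𝕄 ∣ n
            b = proj₁ realised-in
            b~β : M′.SameGalois ⟦ ι ∘ B ⟧ (ι ∘ b) β
            b~β = let θ , fix , e = proj₂ realised-in in
              θ , (λ { (i , refl) → fix (proj₂ (proj₂ found) (lift i)) }) , e
            B↦c : ∀ i → AutEq._↦_ f (B i) (c i)
            B↦c i = restrict⇒↦ f (⁻¹-inverseʳ σ (c i))
            σb∈p : (ι ∘ to σ ∘ b) ∈ p at c
            σb∈p = stable c B (λ j → j , B↦c j) (λ i → i , B↦c i) b (to σ ∘ b)
              (λ i → restrict⇒↦ f refl) (⇐ (at⇔ B) (galois-sym′ b~β))
            σb~τβ : M′.SameGalois ⟦ ι ∘ c ⟧ (ι ∘ to σ ∘ b) (to τ ∘ β)
            σb~τβ = galois-conjugate′ τ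
              (λ { (i , refl) → ι (B i) , (i , refl) ,
                   trans (τ∘ι (B i)) (cong ι (⁻¹-inverseʳ σ (c i))) })
              (τ∘ι ∘ b) (λ _ → refl) b~β

          stabilises : TypeInvariant f → Stabilises 𝓔 f p
          stabilises inv A B _ A⊆fB b b′ b↦b′ b∈p =
            ⇐ (at⇔ A) (galois-trans′ (inv A) (galois-conjugate′ τ
              (λ { (i , refl) → let j , Bj↦Ai = A⊆fB i in
                   ι (B j) , (j , refl) , sends Bj↦Ai })
              (λ _ → refl) (sends ∘ b↦b′) (⇒ (at⇔ B) b∈p)))
            where
            sends : ∀ {x y} → AutEq._↦_ f x y → to τ (ι x) ≡ ι y
            sends x↦y = trans (τ∘ι _) (cong ι (↦⇒restrict f x↦y))

        module _ {k} {a : Vector ∣ 𝕄 ∣ k} {q : TypeFamily k} (q-describes : Describes q β a) where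

          -- `Describes` applies to `a` with σ⁻¹(d); σ carries this pair to σ(a) with `d`, while τ
          -- carries `β` with ι(σ⁻¹(d)) to τ(β) with ι(d).
          describes-conjugate : ∀ m (c d : Vector ∣ 𝕄 ∣ m) →
            ((to σ ∘ a) ++ d) ⊨⋁ q m c ⇔
            M′.SameGalois ∅ (β ++ (ι ∘ c)) ((to τ ∘ β) ++ (ι ∘ d))
          describes-conjugate m c d = mk⇔
            (λ s → galois-trans′
              (type⇒galois-∅′ (⇐ (q-describes m c d₀) (⊨⋁-resp (galois-sym a~σa) s))) β~τβ)
            (λ t → ⊨⋁-resp a~σa
              (⇒ (q-describes m c d₀) (galois⇒type′ (galois-trans′ t (galois-sym′ β~τβ)))))
            where
            d₀ : Vector ∣ 𝕄 ∣ m
            d₀ = to (σ ⁻¹ᵃ) ∘ d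
            a~σa : M.SameGalois ∅ (a ++ d₀) ((to σ ∘ a) ++ d)
            a~σa = galois-++⁺ σ (λ ()) (λ _ → refl) (⁻¹-inverseʳ σ ∘ d)
            β~τβ : M′.SameGalois ∅ (β ++ (ι ∘ d₀)) ((to τ ∘ β) ++ (ι ∘ d))
            β~τβ = galois-++⁺′ τ (λ ()) (λ _ → refl)
              (λ i → trans (τ∘ι (d₀ i)) (cong ι (⁻¹-inverseʳ σ (d i))))

          invariant⇔E : TypeInvariant f ⇔ E⟨ q ⟩ (to σ ∘ a) a
          invariant⇔E = mk⇔ related invariant
            where
            related : TypeInvariant f → E⟨ q ⟩ (to σ ∘ a) a
            related inv m c d = mk⇔
              (λ s → ⇒ (q-describes m c d) (galois⇒type′
                (galois-trans′ (⇒ (describes-conjugate m c d) s) (galois-sym′ β~τβ))))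
              (λ s → ⇐ (describes-conjugate m c d)
                (galois-trans′ (type⇒galois-∅′ (⇐ (q-describes m c d) s)) β~τβ))
              where
              β~τβ : M′.SameGalois ∅ (β ++ (ι ∘ d)) ((to τ ∘ β) ++ (ι ∘ d))
              β~τβ = galois-absorb′ (inv d)
            invariant : E⟨ q ⟩ (to σ ∘ a) a → TypeInvariant f
            -- The instance d = c suffices: `a ++ c` satisfies q^c trivially, hence so does σ(a)
            -- with `c`, which says t(βc/∅) = t(τ(β)c/∅).
            invariant e c = galois-absorb⁻′ (⇒ (describes-conjugate _ c c)
              (⇐ (e _ c c) (⇒ (q-describes _ c c)
                (galois⇒type′ (galois-refl′ (λ _ → refl))))))

lemma2p77 : (∀ {e} → ExcludedMiddle e) →
    ∀ {ℓ} {L : Language ℓ} (𝒦 : AEC L)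
    (δ : Set ℓ) → ℕ <ᶜ δ →
    (𝕄 : Structure L) → IsMonster 𝒦 δ 𝕄 →
    Models.IsFUR 𝒦 δ 𝕄 →
    (𝕄′ : Structure L) (ι : ∣ 𝕄 ∣ → ∣ 𝕄′ ∣) → IsSupermonster 𝒦 𝕄 𝕄′ ι →
    (𝓔 : Imaginaries 𝕄) → Global.StandingChoice 𝕄 𝕄′ ι 𝓔 →
    ∀ {n} (p : Global.GlobalType 𝕄 𝕄′ ι n) →
    ∃ λ (α : Meq.𝕄eq 𝓔) → Global.IsCanonicalBase 𝕄 𝕄′ ι 𝓔 α p
lemma2p77 em 𝒦 δ ω<δ 𝕄 monster fur 𝕄′ ι super 𝓔 standing p =
  let β , β⊨p = Global.realised p
      k , a , ¬splits = nonSplittingBase β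
      -- The family returned here may differ from the one supplied by `describable`; the
      -- equivalences below rely on it only through `Describes`.
      q , q-describes , s , E⇔E⟨q⟩ =
        standing p β a β⊨p ¬splits (describable β a ¬splits)
  in (a Meq./ s) , λ f →
     E⇔fixes f s a ⇔-∘ (⇔-sym (E⇔E⟨q⟩ _ a)
       ⇔-∘ (invariant⇔E p β⊨p f q-describes ⇔-∘ stabilises⇔invariant p β⊨p f))
  where
  open Monsters em 𝒦 δ ω<δ 𝕄 monster fur 𝕄′ ι super
  open Restriction 𝓔
  open CanonicalBases 𝓔
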